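{- For every integer $k\geq 2$, every $2k$-strong tournament is $k^{*}$-strongly connected.
   Context: A tournament is a digraph in which each pair of distinct vertices is joined by exactly one arc. A digraph is $m$-strong if it has more than $m$ vertices and remains strongly connected after deleting any set of fewer than $m$ vertices. For distinct vertices $u,v$ of a digraph $D$, a strong $k^{*}$-container between $u$ and $v$ is a set of $k$ internally disjoint paths that are either all $(u,v)$-paths or all $(v,u)$-paths, whose union contains every vertex of $D$. $D$ is $k^{*}$-strongly connected if there is a strong $k^{*}$-container between every two distinct vertices of $D$. -}

module Defs where

open import Data.Nat using (ℕ; _<_)
open import Data.Fin using (Fin)
open import Data.Fin.Subset using (Subset; ∣_∣; ∁) renaming (_∈_ to _∈ₛ_)
open import Data.List using (List; []; _∷_)
open import Data.List.Membership.Propositional using (_∈_)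
open import Data.List.Relation.Unary.Unique.Propositional using (Unique)
open import Data.Product using (∃; _×_; proj₁)
open import Data.Sum using (_⊎_)
open import Function using (_on_)
open import Level using (0ℓ)
open import Relation.Binary using (Rel)
open import Relation.Binary.Construct.Closure.ReflexiveTransitive using (Star; ε; _◅_)
open import Relation.Binary.PropositionalEquality using (_≡_; _≢_)
open import Relation.Nullary using (¬_)

-- The arc relation: parallel arcs are not represented.
Digraph : Set → Set₁
Digraph V = Rel V 0ℓ

record IsTournament {V : Set} (D : Digraph V) : Set where
  field
    loopless      : ∀ u → ¬ D u u
    exactlyOneArc : ∀ u v → u ≢ v → (D u v × ¬ D v u) ⊎ (D v u × ¬ D u v)

vertices : ∀ {V : Set} {D : Digraph V} {u v : V} → Star D u v → List V
vertices {u = u} ε       = u ∷ []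
vertices {u = u} (_ ◅ w) = u ∷ vertices w

-- Endpoints are included in `vertices`; the trivial path from u to u is allowed.
record Path {V : Set} (D : Digraph V) (u v : V) : Set where
  constructor mkPath
  field
    walk   : Star D u v
    unique : Unique (vertices walk)

pathVertices : ∀ {V : Set} {D : Digraph V} {u v : V} → Path D u v → List V
pathVertices p = vertices (Path.walk p)

StronglyConnected : ∀ {V : Set} → Digraph V → Set
StronglyConnected D = ∀ x y → Path D x y

-- Surviving vertices are given by membership in the complement, rather than by
-- non-membership in S, because the former is a proposition without function
-- extensionality; hence equality of surviving vertices is equality in Fin n.
delete : ∀ {n} → Digraph (Fin n) → (S : Subset n) → Digraph (∃ λ v → v ∈ₛ ∁ S)
delete D S = D on proj₁

record IsStrong {n : ℕ} (m : ℕ) (D : Digraph (Fin n)) : Set where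
  field
    moreVertices : m < n
    robust       : (S : Subset n) → ∣ S ∣ < m → StronglyConnected (delete D S)

-- A set of k paths is an injective family indexed by Fin k.  Paths are compared
-- through their vertex sequences; distinctness is not implied by internal
-- disjointness, since the path consisting of a single arc could be repeated.
record Container {V : Set} (D : Digraph V) (k : ℕ) (u v : V) : Set where
  field
    path               : Fin k → Path D u v
    distinct           : ∀ i j → i ≢ j → pathVertices (path i) ≢ pathVertices (path j)
    internallyDisjoint : ∀ i j → i ≢ j → ∀ w →
                         w ∈ pathVertices (path i) → w ∈ pathVertices (path j) →
                         w ≡ u ⊎ w ≡ v
    spanning           : ∀ w → ∃ λ i → w ∈ pathVertices (path i)

StrongContainer : ∀ {V : Set} → Digraph V → ℕ → V → V → Set
StrongContainer D k u v = Container D k u v ⊎ Container D k v u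

StarStronglyConnected : ∀ {V : Set} → ℕ → Digraph V → Set
StarStronglyConnected k D = ∀ u v → u ≢ v → StrongContainer D k u v

{-# OPTIONS --safe #-}

-- Let v → u; the k paths found all lead from u to v.  By Menger's theorem there are k + 2 disjoint
-- paths from N⁺(u) to N⁻(v) avoiding u and v.  Insert further single vertices into them as long as
-- possible.  For a remaining vertex r and a path p, an arc from p to r then forces the last vertex
-- of p to dominate r, and an arc from r to p forces r to dominate the first vertex of p.  Let E be
-- the set of remaining vertices dominated by the end of some path and F the set of those dominating
-- the start of some path.  Every remaining vertex is in E or F, and can be reached from E and reaches
-- F through remaining vertices, because T − {u, v} is strong; hence the remaining vertices carry a
-- Hamiltonian path z from E to F.  If z leads from the end of p to the start of q ≠ p, then p z q is
-- a path.  Otherwise it leads back to p, and z can be cut into z₁ z₂ such that, for two further paths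
-- a and b, b z₂ p z₁ a is a path.  So at least k paths remain and cover everything; two paths from
-- N⁺(u) to N⁻(v) can always be merged into one, which brings their number down to k.
module Submission where

open import Data.Nat using (ℕ; zero; suc; _+_; _*_; _≤_; _<_; z≤n; s≤s; _≤?_)
open import Data.Nat.Properties using (≤-trans; ≤-reflexive; ≰⇒>; m≤n⇒m⊓n≡m; suc-injective; m≤n+m; +-identityʳ; ≤-<-trans; <-≤-trans; +-monoˡ-≤)
open import Data.List using (List; []; _∷_; [_]; _++_; _∷ʳ_; length; concat; map; filter; take; deduplicate; foldr; cartesianProduct; allFin; lookup)
open import Data.List.Properties using (length-++; length-map; length-take; concat-map-[_]; ∷-injectiveˡ; ∷-injectiveʳ; ++-identityʳ; ++-assoc; length-filter)
open import Data.List.Membership.Propositional using (_∈_; _∉_; find; lose)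
open import Data.List.Membership.Propositional.Properties using (∈-++⁺ˡ; ∈-++⁺ʳ; ∈-++⁻; ∈-∃++; ∈-concat⁺′; ∈-concat⁻′; ∈-filter⁺; ∈-filter⁻; ∈-deduplicate⁺; ∈-deduplicate⁻; ∈-map⁻; ∈-allFin; ∈-cartesianProduct⁺; ∈-cartesianProduct⁻; ∈-lookup; ∈-concat⁻)
import Data.List.Membership.DecPropositional as DecMembership
open import Data.List.Relation.Unary.All as All using (All; []; _∷_)
import Data.List.Relation.Unary.All.Properties as Allₚ
open import Data.List.Relation.Unary.Any as Any using (Any; here; there)
open import Data.List.Relation.Unary.AllPairs using ([]; _∷_)
open import Data.List.Relation.Unary.Unique.Propositional using (Unique)
import Data.List.Relation.Unary.Unique.Propositional.Properties as Uniqueₚ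
import Data.List.Relation.Unary.Unique.DecPropositional.Properties as DecUnique
open import Data.List.Relation.Binary.Disjoint.Propositional using (Disjoint)
open import Data.List.Relation.Binary.Permutation.Propositional using (_↭_; refl; prep; swap; trans; ↭-refl; ↭-sym; ↭-trans; ↭-reflexive; ↭⇒↭ₛ)
open import Data.List.Relation.Binary.Permutation.Propositional.Properties using (shift; ++⁺; ++⁺ˡ; ++⁺ʳ; ++-comm; ∷↭∷ʳ; ↭-length; ↭-map-inv; All-resp-↭; Any-resp-↭; ∈-resp-↭; shifts; ++-commutativeMonoid) renaming (map⁺ to map⁺-↭)
import Data.List.Relation.Binary.Permutation.Setoid.Properties as Permutationₛ
import Algebra.Solver.CommutativeMonoid as CommutativeMonoidSolver
open import Data.Product using (∃; ∃₂; _×_; _,_; proj₁; proj₂)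
open import Data.Sum using (_⊎_; inj₁; inj₂; [_,_]′)
open import Data.Empty using (⊥; ⊥-elim)
open import Function using (_∘_; id; case_of_)
open import Relation.Binary using (DecidableEquality)
open import Relation.Binary.PropositionalEquality using (_≡_; _≢_; refl; sym; cong; subst; setoid; ≢-sym) renaming (trans to ≡-trans)
open import Relation.Nullary using (¬_; yes; no; Dec)
open import Data.Nat.Induction using (<-wellFounded)
open import Induction.WellFounded using (Acc; acc)
open import Data.Fin using (Fin; zero; suc)
import Data.Fin as Fin
open import Data.Fin.Subset using (Subset; inside; outside; ∣_∣; ∁; ⁅_⁆; _∪_) renaming (_∈_ to _∈ₛ_; ⊥ to ∅)
open import Data.Fin.Subset.Properties using (∣⊥∣≡0; ∉⊥; ∪-identityˡ; x∈⁅x⁆; x∈⁅y⁆⇒x≡y; x∈p∪q⁺; x∈p∪q⁻; x∈∁p⇒x∉p; x∉p⇒x∈∁p)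
import Data.Vec as Vec
open import Data.Vec.Properties.WithK using ([]=-irrelevant)
open import Data.List.Relation.Unary.Any.Properties using (lookup-index)
open import Relation.Binary.Construct.Closure.ReflexiveTransitive using (Star; ε; _◅_)
open import Relation.Nullary.Decidable using (¬?; _×-dec_)
open import Relation.Unary using () renaming (Decidable to Decidable₁)
open import Defs

private variable
  V : Set

-- Lists up to permutation

Unique-resp-↭ : {xs ys : List V} → xs ↭ ys → Unique xs → Unique ys
Unique-resp-↭ xs↭ys = Permutationₛ.Unique-resp-↭ (setoid _) (↭⇒↭ₛ xs↭ys)

Unique-++⁻ˡ : ∀ (xs : List V) {ys} → Unique (xs ++ ys) → Unique xs
Unique-++⁻ˡ []       _          = []
Unique-++⁻ˡ (x ∷ xs) (x∉ ∷ u) = Allₚ.++⁻ˡ xs x∉ ∷ Unique-++⁻ˡ xs u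

Unique-++⁻ʳ : ∀ (xs : List V) {ys} → Unique (xs ++ ys) → Unique ys
Unique-++⁻ʳ []       u       = u
Unique-++⁻ʳ (x ∷ xs) (_ ∷ u) = Unique-++⁻ʳ xs u

Unique⇒Disjoint : ∀ (xs : List V) {ys} → Unique (xs ++ ys) → Disjoint xs ys
Unique⇒Disjoint (x ∷ xs) (x∉ ∷ u) (here refl , v∈ys) = All.lookup x∉ (∈-++⁺ʳ xs v∈ys) refl
Unique⇒Disjoint (x ∷ xs) (_ ∷ u)  (there v∈xs , v∈ys) = Unique⇒Disjoint xs u (v∈xs , v∈ys)

∈⇒↭∷ : {x : V} {xs : List V} → x ∈ xs → ∃ λ ys → xs ↭ x ∷ ys
∈⇒↭∷ x∈xs with ys , zs , refl ← ∈-∃++ x∈xs = ys ++ zs , shift _ ys zs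

drop-∈ : {x v : V} {ys : List V} → x ≢ v × v ∈ x ∷ ys → v ∈ ys
drop-∈ (x≢v , here refl) = ⊥-elim (x≢v refl)
drop-∈ (_   , there v∈)  = v∈

extract : {xs ys : List V} → Unique xs → All (_∈ ys) xs → ∃ λ zs → ys ↭ xs ++ zs
extract {ys = ys} []         []          = ys , ↭-refl
extract (x∉ ∷ u) (x∈ ∷ xs⊆ys)
  with _  , ys↭  ← ∈⇒↭∷ x∈
  with zs , ys′↭ ← extract u (All.map drop-∈ (All.zip (x∉ , All.map (∈-resp-↭ ys↭) xs⊆ys)))
  = zs , ↭-trans ys↭ (prep _ ys′↭)

-- Pigeonhole: anything that `extract` leaves over would make `ys` longer than `xs`.
extract-all : {xs ys : List V} → Unique xs → All (_∈ ys) xs → length ys ≤ length xs → xs ↭ ys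
extract-all {xs = xs} u xs⊆ys len with extract u xs⊆ys
... | []     , ys↭ = ↭-sym (subst (_ ↭_) (++-identityʳ xs) ys↭)
... | z ∷ zs , ys↭ = ⊥-elim (1+m+n≰m (subst (_≤ length xs) (≡-trans (↭-length ys↭) (length-++ xs)) len))
  where
  1+m+n≰m : ∀ {m n} → ¬ (m + suc n ≤ m)
  1+m+n≰m {suc m} (s≤s p) = 1+m+n≰m p

concat-resp-↭ : {xss yss : List (List V)} → xss ↭ yss → concat xss ↭ concat yss
concat-resp-↭ refl           = ↭-refl
concat-resp-↭ (prep xs p)    = ++⁺ˡ xs (concat-resp-↭ p)
concat-resp-↭ (swap xs ys p) = ↭-trans (++⁺ˡ xs (++⁺ˡ ys (concat-resp-↭ p))) (shifts xs ys)
concat-resp-↭ (trans p q)    = ↭-trans (concat-resp-↭ p) (concat-resp-↭ q)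

module ↭-Solver {V : Set} = CommutativeMonoidSolver (++-commutativeMonoid {A = V})

-- Chains

-- Vertices may repeat: simplicity and disjointness are imposed by Unique on vertex lists.
data Chain (D : Digraph V) (X Y : V → Set) : List V → Set where
  end  : ∀ {x} → X x → Y x → Chain D X Y [ x ]
  step : ∀ {x l} → X x → Chain D (D x) Y l → Chain D X Y (x ∷ l)

module _ {D : Digraph V} where

  private variable
    X X′ Y Y′ Z W : V → Set
    l l₁ l₂ : List V

  rehead : ∀ {x} → X′ x → Chain D X Y (x ∷ l) → Chain D X′ Y (x ∷ l)
  rehead X′x (end _ Yx) = end X′x Yx
  rehead X′x (step _ c) = step X′x c

  head-holds : ∀ {x} → Chain D X Y (x ∷ l) → X x
  head-holds (end Xx _)  = Xx
  head-holds (step Xx _) = Xx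

  mapˡ : (∀ {x} → X x → X′ x) → Chain D X Y l → Chain D X′ Y l
  mapˡ f (end Xx Yx) = end (f Xx) Yx
  mapˡ f (step Xx c) = step (f Xx) c

  mapʳ : (∀ {x} → Y x → Y′ x) → Chain D X Y l → Chain D X Y′ l
  mapʳ f (end Xx Yx) = end Xx (f Yx)
  mapʳ f (step Xx c) = step Xx (mapʳ f c)

  join : (∀ {x y} → Z x → W y → D x y) → Chain D X Z l₁ → Chain D W Y l₂ → Chain D X Y (l₁ ++ l₂)
  join f (end Xx Zx) c = step Xx (mapˡ (f Zx) c)
  join f (step Xx b) c = step Xx (join f b c)

  cross : Chain D X Y l → Chain D X′ Y′ l → Chain D X Y′ l
  cross (end Xx _)  (end _ Y′x) = end Xx Y′x
  cross (end _ _)   (step _ ())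
  cross (step _ ()) (end _ _)
  cross (step Xx _) (step _ c)  = step Xx c

  head-of : Chain D X Y l → ∃ λ x → X x × Chain D (_≡ x) Y l
  head-of (end Xx Yx) = _ , Xx , end refl Yx
  head-of (step Xx c) = _ , Xx , step refl c

  last-of : Chain D X Y l → ∃ λ y → Y y × Chain D X (_≡ y) l
  last-of (end Xx Yx) = _ , Yx , end Xx refl
  last-of (step Xx c) with y , Yy , c′ ← last-of c = y , Yy , step Xx c′

  head-∈ : ∀ {x} → Chain D (_≡ x) Y l → x ∈ l
  head-∈ (end refl _)  = here refl
  head-∈ (step refl _) = here refl

  last-∈ : ∀ {y} → Chain D X (_≡ y) l → y ∈ l
  last-∈ (end _ refl) = here refl
  last-∈ (step _ c)   = there (last-∈ c)

  uncons : ∀ {x} → Chain D (_≡ x) Y l → ∃ λ l′ → l ≡ x ∷ l′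
  uncons (end refl _)  = _ , refl
  uncons (step refl _) = _ , refl

  unsnoc : ∀ {y} → Chain D X (_≡ y) l → ∃ λ l′ → l ≡ l′ ∷ʳ y
  unsnoc (end _ refl) = [] , refl
  unsnoc (step {x = x} _ c) with l′ , refl ← unsnoc c = x ∷ l′ , refl

  join-at : ∀ {x} l₁ → Chain D X (_≡ x) (l₁ ∷ʳ x) → Chain D (_≡ x) Y (x ∷ l₂) →
            Chain D X Y (l₁ ++ x ∷ l₂)
  join-at []           (end Xx refl) c = rehead Xx c
  join-at []           (step _ ())   c
  join-at (_ ∷ [])     (step Xx b)   c = step Xx (join-at [] b c)
  join-at (_ ∷ y ∷ l₁) (step Xx b)   c = step Xx (join-at (y ∷ l₁) b c)

  -- Splitting off `l₂` confines the prefix to `l₁`. For a chain `i ∷ʳ t` ending in a separator and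
  -- a vertex of `i`, the prefix then consists of vertices of `i`, which avoid the separator.
  prefix : ∀ {x} → x ∈ l₁ → Chain D X Y (l₁ ++ l₂) →
           ∃ λ l → Chain D X (_≡ x) (l ∷ʳ x) × All (_∈ l₁) (l ∷ʳ x)
  prefix (here refl) c = [] , end (head-holds c) refl , here refl ∷ []
  prefix {l₁ = y ∷ _ ∷ _} (there x∈) (step Xy c) with l , c′ , l⊆ ← prefix x∈ c
    = y ∷ l , step Xy c′ , here refl ∷ All.map there l⊆

  suffix : ∀ {x} → x ∈ l → Chain D X Y l →
           ∃ λ l′ → Chain D (_≡ x) Y (x ∷ l′) × All (_∈ l) (x ∷ l′)
  suffix (here refl) c = _ , rehead refl c , All.tabulate id
  suffix (there x∈) (step _ c) with l , c′ , l⊆ ← suffix x∈ c = l , c′ , All.map there l⊆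

map-arcs : {D D′ : Digraph V} {X Y : V → Set} {l : List V} →
           (∀ {x y} → D x y → D′ x y) → Chain D X Y l → Chain D′ X Y l
map-arcs f (end Xx Yx) = end Xx Yx
map-arcs f (step Xx c) = step Xx (mapˡ f (map-arcs f c))

-- Menger's theorem

Arc : List (V × V) → Digraph V
Arc E x y = (x , y) ∈ E

Separates : List (V × V) → (A B S : List V) → Set
Separates E A B S = ∀ {l} → Chain (Arc E) (_∈ A) (_∈ B) l → ∃ λ x → x ∈ l × x ∈ S

DisjointChains : Digraph V → (X Y : V → Set) → ℕ → Set
DisjointChains D X Y k =
  ∃ λ ps → length ps ≡ k × All (Chain D X Y) ps × Unique (concat ps)

-- The left part stops at the first use of the new arc and the right part starts after its last use,
-- so neither of them uses it.
first-arc? : ∀ {x y : V} {E X Y l} → Chain (Arc ((x , y) ∷ E)) X Y l →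
  Chain (Arc E) X Y l ⊎
  (∃ λ l₁ → Chain (Arc E) X (_≡ x) l₁ × All (_∈ l) l₁) ×
  (∃ λ l₂ → Chain (Arc E) (_≡ y) Y l₂ × All (_∈ l) l₂)
first-arc? (end Xa Ya) = inj₁ (end Xa Ya)
first-arc? (step {x = a} Xa c) with first-arc? c
... | inj₁ c′ with head-of c′
...   | h , here refl , c″ = inj₂ ((_ , end Xa refl , here refl ∷ []) , (_ , c″ , All.tabulate there))
...   | h , there ah  , c″ = inj₁ (step Xa (mapˡ (λ { refl → ah }) c″))
first-arc? (step {x = a} Xa c) | inj₂ ((l₁ , c₁ , l₁⊆) , (l₂ , c₂ , l₂⊆)) with head-of c₁
...   | h , here refl , c″ = inj₂ ((_ , end Xa refl , here refl ∷ []) , (l₂ , c₂ , All.map there l₂⊆))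
...   | h , there ah  , c″ = inj₂ ((_ , step Xa (mapˡ (λ { refl → ah }) c″) , here refl ∷ All.map there l₁⊆) , (l₂ , c₂ , All.map there l₂⊆))

module _ {D : Digraph V} {X Y : V → Set} where

  -- A chain ending (starting) in a given set is stored as its last (first) vertex together with
  -- the remaining vertices.
  split-lasts : ∀ {ps} → All (Chain D X Y) ps → ∃ λ its → length its ≡ length ps ×
    All (λ (t , i) → Chain D X (_≡ t) (i ∷ʳ t) × Y t) its ×
    concat ps ↭ map proj₁ its ++ concat (map proj₂ its)
  split-lasts [] = [] , refl , [] , ↭-refl
  split-lasts (_∷_ {xs = ps} c cs)
    with t , Yt , c′ ← last-of c
    with i , refl ← unsnoc c′
    with its , len , cs′ , perm ← split-lasts cs
    = (t , i) ∷ its , cong suc len , (c′ , Yt) ∷ cs′ ,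
      ↭-trans (++⁺ˡ (i ∷ʳ t) perm)
        (solve 4 (λ i t a b → (i ⊕ t) ⊕ (a ⊕ b) ⊜ t ⊕ (a ⊕ (i ⊕ b))) ↭-refl
          i [ t ] (map proj₁ its) (concat (map proj₂ its)))
    where open ↭-Solver

  split-heads : ∀ {ps} → All (Chain D X Y) ps → ∃ λ its → length its ≡ length ps ×
    All (λ (t , i) → Chain D (_≡ t) Y (t ∷ i) × X t) its ×
    concat ps ↭ map proj₁ its ++ concat (map proj₂ its)
  split-heads [] = [] , refl , [] , ↭-refl
  split-heads (_∷_ {xs = ps} c cs)
    with t , Xt , c′ ← head-of c
    with i , refl ← uncons c′
    with its , len , cs′ , perm ← split-heads cs
    = (t , i) ∷ its , cong suc len , (c′ , Xt) ∷ cs′ ,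
      ↭-trans (++⁺ˡ (t ∷ i) perm)
        (solve 4 (λ i t a b → (t ⊕ i) ⊕ (a ⊕ b) ⊜ t ⊕ (a ⊕ (i ⊕ b))) ↭-refl
          i [ t ] (map proj₁ its) (concat (map proj₂ its)))
    where open ↭-Solver

  weave : ∀ its jts → map proj₁ its ≡ map proj₁ jts →
    All (λ (t , i) → Chain D X (_≡ t) (i ∷ʳ t)) its →
    All (λ (t , j) → Chain D (_≡ t) Y (t ∷ j)) jts →
    ∃ λ ps → length ps ≡ length its × All (Chain D X Y) ps ×
      concat ps ↭ map proj₁ its ++ (concat (map proj₂ its) ++ concat (map proj₂ jts))
  weave [] [] _ _ _ = [] , refl , [] , ↭-refl
  weave ((t , i) ∷ its) ((_ , j) ∷ jts) eq (c ∷ cs) (d ∷ ds)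
    with refl ← ∷-injectiveˡ eq
    with ps , len , es , perm ← weave its jts (∷-injectiveʳ eq) cs ds
    = (i ++ t ∷ j) ∷ ps , cong suc len , join-at i c d ∷ es ,
      ↭-trans (++⁺ˡ (i ++ t ∷ j) perm)
        (solve 6 (λ i t j a b c → (i ⊕ (t ⊕ j)) ⊕ (a ⊕ (b ⊕ c)) ⊜ t ⊕ (a ⊕ ((i ⊕ b) ⊕ (j ⊕ c)))) ↭-refl
          i [ t ] j (map proj₁ its) (concat (map proj₂ its)) (concat (map proj₂ jts)))
    where open ↭-Solver

-- Distinct ends lying in a list no longer than their number exhaust that list, so the pairs can be
-- reordered until their ends read exactly `S`.
align : ∀ {S : List V} {P : V × List V → Set} its → All P its → All (λ (t , _) → t ∈ S) its →
  Unique (map proj₁ its ++ concat (map proj₂ its)) → length S ≤ length its →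
  ∃ λ its′ → map proj₁ its′ ≡ S × length its ≡ length its′ × All P its′ ×
    Unique (map proj₁ its′ ++ concat (map proj₂ its′))
align its Ps ⊆S u len
  with its′ , eq , its↭ ← ↭-map-inv proj₁ (extract-all (Unique-++⁻ˡ (map proj₁ its) u)
         (Allₚ.map⁺ ⊆S) (subst (_ ≤_) (sym (length-map proj₁ its)) len))
  = its′ , sym eq , ↭-length its↭ , All-resp-↭ its↭ Ps ,
    Unique-resp-↭ (++⁺ (map⁺-↭ proj₁ its↭) (concat-resp-↭ (map⁺-↭ proj₂ its↭))) u

-- In Göring's proof of Menger's theorem: if S separates A from B, then disjoint chains from A to
-- x ∷ S and from y ∷ S to B meet only in S, and so fit together at S and along the arc (x , y).
module _ {E : List (V × V)} {A B : List V} {x y : V} {i₀ j₀ : List V} {its jts : List (V × List V)} where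

  private
    S = map proj₁ its
    I = i₀ ++ concat (map proj₂ its)
    J = j₀ ++ concat (map proj₂ jts)

  glue-aligned : Separates E A B S → map proj₁ jts ≡ S →
    All (λ (t , i) → Chain (Arc E) (_∈ A) (_≡ t) (i ∷ʳ t)) ((x , i₀) ∷ its) →
    All (λ (t , j) → Chain (Arc E) (_≡ t) (_∈ B) (t ∷ j)) ((y , j₀) ∷ jts) →
    Unique (x ∷ S ++ I) → Unique (y ∷ S ++ J) →
    DisjointChains (Arc ((x , y) ∷ E)) (_∈ A) (_∈ B) (suc (length its))
  glue-aligned sep eq (c₀ ∷ cs) (d₀ ∷ ds) uI uJ
    with ps , |ps| , es , ps↭ ← weave its jts (sym eq) cs ds
    = _ , cong suc |ps| ,
      join (λ { refl refl → here refl }) (map-arcs there c₀) (map-arcs there d₀) ∷ All.map (map-arcs there) es ,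
      Unique-resp-↭ (regroup ps ps↭) (Uniqueₚ.++⁺ uI (Unique-++⁻ʳ S uJ′) disjoint)
    where
    uI′ : Unique (S ++ x ∷ I)
    uI′ = Unique-resp-↭ (↭-sym (shift x S I)) uI
    uJ′ : Unique (S ++ y ∷ J)
    uJ′ = Unique-resp-↭ (↭-sym (shift y S J)) uJ

    regroup : ∀ ps → concat ps ↭ S ++ (concat (map proj₂ its) ++ concat (map proj₂ jts)) →
              (x ∷ S ++ I) ++ y ∷ J ↭ ((i₀ ∷ʳ x) ++ y ∷ j₀) ++ concat ps
    regroup ps ps↭ = ↭-trans
      (solve 7 (λ x y s i j i₀ j₀ → (x ⊕ (s ⊕ (i₀ ⊕ i))) ⊕ (y ⊕ (j₀ ⊕ j)) ⊜ ((i₀ ⊕ x) ⊕ (y ⊕ j₀)) ⊕ (s ⊕ (i ⊕ j)))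
        ↭-refl [ x ] [ y ] S (concat (map proj₂ its)) (concat (map proj₂ jts)) i₀ j₀)
      (++⁺ˡ ((i₀ ∷ʳ x) ++ y ∷ j₀) (↭-sym ps↭))
      where open ↭-Solver

    from-A : ∀ {w} → w ∈ x ∷ I →
             ∃ λ l → Chain (Arc E) (_∈ A) (_≡ w) (l ∷ʳ w) × All (_∈ x ∷ I) (l ∷ʳ w)
    from-A (here refl) = i₀ , c₀ , Allₚ.∷ʳ⁺ (All.tabulate (there ∘ ∈-++⁺ˡ)) (here refl)
    from-A (there w∈I)
      with i , w∈i , i∈ ← ∈-concat⁻′ (map proj₂ ((x , i₀) ∷ its)) w∈I
      with _ , ti∈ , refl ← ∈-map⁻ proj₂ i∈
      with l , c , l⊆ ← prefix w∈i (All.lookup (c₀ ∷ cs) ti∈)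
      = l , c , All.map (λ v∈i → there (∈-concat⁺′ v∈i i∈)) l⊆

    to-B : ∀ {w} → w ∈ y ∷ J →
           ∃ λ l → Chain (Arc E) (_≡ w) (_∈ B) (w ∷ l) × All (_∈ y ∷ J) (w ∷ l)
    to-B (here refl) = j₀ , d₀ , here refl ∷ All.tabulate (there ∘ ∈-++⁺ˡ)
    to-B (there w∈J)
      with j , w∈j , j∈ ← ∈-concat⁻′ (map proj₂ ((y , j₀) ∷ jts)) w∈J
      with _ , tj∈ , refl ← ∈-map⁻ proj₂ j∈
      with All.lookup (d₀ ∷ ds) tj∈
    ... | end _ _ = case w∈j of λ ()
    ... | step _ d with l , d′ , l⊆ ← suffix w∈j d
      = l , d′ , All.map (λ v∈j → there (∈-concat⁺′ v∈j j∈)) l⊆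

    -- A chain from `A` to `w` within `x ∷ I`, continued from `w` to `B` within `y ∷ J`, would be a
    -- chain over `E` from `A` to `B` that misses the separator `S`.
    meets-S : ∀ {w} → w ∈ x ∷ I → w ∈ y ∷ J → ⊥
    meets-S w∈I w∈J
      with l , c , l⊆ ← from-A w∈I
      with l′ , d , l′⊆ ← to-B w∈J
      with v , v∈ , v∈S ← sep (join-at l c d)
      with ∈-++⁻ l v∈
    ... | inj₁ v∈l  = Unique⇒Disjoint S uI′ (v∈S , All.lookup l⊆ (∈-++⁺ˡ v∈l))
    ... | inj₂ v∈l′ = Unique⇒Disjoint S uJ′ (v∈S , All.lookup l′⊆ v∈l′)

    disjoint : Disjoint (x ∷ S ++ I) (y ∷ J)
    disjoint (w∈ , w∈J) with ∈-++⁻ S (∈-resp-↭ (↭-sym (shift x S I)) w∈)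
    ... | inj₁ w∈S = Unique⇒Disjoint S uJ′ (w∈S , w∈J)
    ... | inj₂ w∈I = meets-S w∈I w∈J

-- There are `k` chains on either side and at most `k` entries in `x ∷ S` and in `y ∷ S`. Hence
-- every entry is the end of exactly one chain, and `align` lists the ends on both sides in the same
-- order of `S`.
glue : ∀ {E : List (V × V)} {x y A B S k} → Separates E A B S → length S < k →
  DisjointChains (Arc E) (_∈ A) (_∈ x ∷ S) k → DisjointChains (Arc E) (_∈ y ∷ S) (_∈ B) k →
  DisjointChains (Arc ((x , y) ∷ E)) (_∈ A) (_∈ B) k
glue {x = x} {y} {S = S} sep S<k (ps , |ps| , cs , ups) (qs , |qs| , ds , uqs)
  with its₀ , |its₀| , cs₀ , ps↭ ← split-lasts cs
  with jts₀ , |jts₀| , ds₀ , qs↭ ← split-heads ds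
  with (_ , i₀) ∷ its , refl , |its| , cs′ , uI ←
         align {S = x ∷ S} its₀ (All.map proj₁ cs₀) (All.map proj₂ cs₀) (Unique-resp-↭ ps↭ ups)
           (subst (_ ≤_) (sym (≡-trans |its₀| |ps|)) S<k)
  with (_ , j₀) ∷ jts , eq , _ , ds′ , uJ ←
         align {S = y ∷ map proj₁ its} jts₀ (All.map proj₁ ds₀) (All.map proj₂ ds₀) (Unique-resp-↭ qs↭ uqs)
           (subst (_ ≤_) (sym (≡-trans |jts₀| |qs|)) S<k)
  with refl ← ∷-injectiveˡ eq
  = subst (DisjointChains _ _ _) (≡-trans (sym |its|) (≡-trans |its₀| |ps|))
      (glue-aligned sep (∷-injectiveʳ eq) cs′ ds′ uI
        (subst (λ l → Unique (y ∷ l ++ _)) (∷-injectiveʳ eq) uJ))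

module _ (_≟_ : DecidableEquality V) where

  open DecMembership _≟_ using (_∈?_)

  common : (A B : List V) → List V
  common A B = filter (_∈? B) (deduplicate _≟_ A)

  -- Induction on the arcs. If a small `S` separates `A` from `B` before the arc `(x , y)` is added,
  -- the hypothesis is applied from `A` to `x ∷ S` and from `y ∷ S` to `B`. A small separator for
  -- either pair also separates `A` from `B` once the arc is there; otherwise the two families are
  -- glued.
  menger : ∀ E (A B : List V) k →
    (∃ λ S → length S < k × Separates E A B S) ⊎ DisjointChains (Arc E) (_∈ A) (_∈ B) k
  menger [] A B k with k ≤? length (common A B)
  -- Without arcs every chain is a single vertex, so the common vertices of `A` and `B` serve as
  -- chains when there are enough of them and as a separator when there are not.
  ... | yes k≤C = inj₂ (map [_] (take k C) , |C| , Allₚ.map⁺ (Allₚ.take⁺ k singletons) ,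
                        subst Unique (sym (concat-map-[_] (take k C)))
                          (Uniqueₚ.take⁺ k (Uniqueₚ.filter⁺ (_∈? B) (DecUnique.deduplicate-! _≟_ A))))
    where
    C = common A B
    |C| : length (map [_] (take k C)) ≡ k
    |C| = ≡-trans (length-map [_] (take k C)) (≡-trans (length-take k C) (m≤n⇒m⊓n≡m k≤C))
    singletons : All (λ x → Chain (Arc []) (_∈ A) (_∈ B) [ x ]) C
    singletons = All.tabulate λ x∈C → case ∈-filter⁻ (_∈? B) {xs = deduplicate _≟_ A} x∈C of
      λ (x∈A , x∈B) → end (∈-deduplicate⁻ _≟_ A x∈A) x∈B
  ... | no k≰C = inj₁ (common A B , ≰⇒> k≰C , sep)
    where
    sep : Separates [] A B (common A B)
    sep (end x∈A x∈B) = _ , here refl , ∈-filter⁺ (_∈? B) (∈-deduplicate⁺ _≟_ x∈A) x∈B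
    sep (step _ (end () _))
    sep (step _ (step () _))
  menger ((x , y) ∷ E) A B k with menger E A B k
  ... | inj₂ (ps , |ps| , cs , u) = inj₂ (ps , |ps| , All.map (map-arcs there) cs , u)
  ... | inj₁ (S , S<k , sep) with menger E A (x ∷ S) k | menger E (y ∷ S) B k
  ...   | inj₂ P | inj₂ Q = inj₂ (glue sep S<k P Q)
  ...   | inj₁ (S′ , S′<k , sep′) | _ = inj₁ (S′ , S′<k , through-x)
    where
    -- A chain that avoids the new arc meets `S` and is stopped there; one that uses it is stopped
    -- at its first visit to `x` by that arc. Either piece is a chain over `E` from `A` to `x ∷ S`.
    through-x : Separates ((x , y) ∷ E) A B S′
    through-x {l} c with first-arc? c
    ... | inj₁ c′ = case sep c′ of λ (s , s∈l , s∈S) →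
      case prefix s∈l (subst (Chain _ _ _) (sym (++-identityʳ l)) c′) of λ (_ , c″ , l⊆) →
      case sep′ (mapʳ (λ { refl → there s∈S }) c″) of λ (v , v∈ , v∈S′) → v , All.lookup l⊆ v∈ , v∈S′
    ... | inj₂ ((_ , c′ , l⊆) , _) =
      case sep′ (mapʳ here c′) of λ (v , v∈ , v∈S′) → v , All.lookup l⊆ v∈ , v∈S′
  ...   | inj₂ _ | inj₁ (S′ , S′<k , sep′) = inj₁ (S′ , S′<k , through-y)
    where
    through-y : Separates ((x , y) ∷ E) A B S′
    through-y c with first-arc? c
    ... | inj₁ c′ = case sep c′ of λ (s , s∈l , s∈S) →
      case suffix s∈l c′ of λ (_ , c″ , l⊆) →
      case sep′ (mapˡ (λ { refl → there s∈S }) c″) of λ (v , v∈ , v∈S′) → v , All.lookup l⊆ v∈ , v∈S′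
    ... | inj₂ (_ , (_ , c′ , l⊆)) =
      case sep′ (mapˡ here c′) of λ (v , v∈ , v∈S′) → v , All.lookup l⊆ v∈ , v∈S′

-- Inserting chains into chains of a tournament

∉⇒≢ : {x y : V} {l : List V} → x ∈ l → y ∉ l → x ≢ y
∉⇒≢ x∈ y∉ refl = y∉ x∈

empty-or-∈ : (xs : List V) → xs ≡ [] ⊎ ∃ (_∈ xs)
empty-or-∈ []      = inj₁ refl
empty-or-∈ (_ ∷ _) = inj₂ (_ , here refl)

all-or : {A : Set} {P : V → Set} (xs : List V) → (∀ {x} → x ∈ xs → A ⊎ P x) → A ⊎ All P xs
all-or []       f = inj₂ []
all-or (x ∷ xs) f with f (here refl) | all-or xs (f ∘ there)
... | inj₁ a | _       = inj₁ a
... | inj₂ _ | inj₁ a  = inj₁ a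
... | inj₂ p | inj₂ ps = inj₂ (p ∷ ps)

module Semicomplete {D : Digraph V} (total : ∀ {x y} → x ≢ y → D x y ⊎ D y x) where

  private variable
    X Y Z W : V → Set
    l z : List V

  record Absorbed (X Y : V → Set) (l z : List V) : Set where
    constructor absorbed
    field
      {list} : List V
      chain  : Chain D X Y list
      list↭  : list ↭ l ++ z

  cons : ∀ {x} → X x → Absorbed (D x) Y l z → Absorbed X Y (x ∷ l) z
  cons Xx (absorbed c p) = absorbed (step Xx c) (prep _ p)

  cons′ : ∀ {x} → X x → Absorbed (D x) Y l z → Absorbed X Y l (x ∷ z)
  cons′ {l = l} {z} {x} Xx (absorbed c p) = absorbed (step Xx c) (↭-trans (prep x p) (↭-sym (shift x l z)))

  disjointˡ : ∀ {x} → Disjoint (x ∷ l) z → Disjoint l z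
  disjointˡ dis (v∈l , v∈z) = dis (there v∈l , v∈z)

  disjointʳ : ∀ {x} → Disjoint l (x ∷ z) → Disjoint l z
  disjointʳ dis (v∈l , v∈z) = dis (v∈l , there v∈z)

  compare : ∀ {x y} → Disjoint (x ∷ l) (y ∷ z) → D x y ⊎ D y x
  compare dis = total λ { refl → dis (here refl , here refl) }

  append : ∀ {x} → X x → Chain D (D x) Y l → Absorbed X Y l [ x ]
  append Xx c = absorbed (step Xx c) (∷↭∷ʳ _ _)

  -- Two chains are merged like sorted lists.
  merge : ∀ l z → Chain D X Y l → Chain D X Y z → Disjoint l z → Absorbed X Y l z
  merge (x ∷ l) (y ∷ z) c@(end Xx _) d@(end Xy _) dis =
    [ (λ xy → absorbed (step Xx (rehead xy d)) ↭-refl) , (λ yx → append Xy (rehead yx c)) ]′ (compare dis)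
  merge (x ∷ l) (y ∷ z) c@(end Xx _) d@(step Xy d′) dis =
    [ (λ xy → absorbed (step Xx (rehead xy d)) ↭-refl)
    , (λ yx → cons′ Xy (merge (x ∷ l) z (rehead yx c) d′ (disjointʳ dis))) ]′ (compare dis)
  merge (x ∷ l) (y ∷ z) c@(step Xx c′) d@(end Xy _) dis =
    [ (λ xy → cons Xx (merge l (y ∷ z) c′ (rehead xy d) (disjointˡ dis)))
    , (λ yx → append Xy (rehead yx c)) ]′ (compare dis)
  merge (x ∷ l) (y ∷ z) c@(step Xx c′) d@(step Xy d′) dis =
    [ (λ xy → cons Xx (merge l (y ∷ z) c′ (rehead xy d) (disjointˡ dis)))
    , (λ yx → cons′ Xy (merge (x ∷ l) z (rehead yx c) d′ (disjointʳ dis))) ]′ (compare dis)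

  -- The end of `z` need not satisfy `Y`, so `z` has to be used up before `w`. Merging proceeds
  -- until `w` comes up, and what is left of `z` then goes in front of `w`.
  insert-before : ∀ l z {w} → w ∈ l → Chain D X Y l → Chain D X (λ x → D x w) z → Disjoint l z →
                  Absorbed X Y l z
  insert-before (w ∷ l) z (here refl) c d dis =
    absorbed (join {W = _≡ w} (λ { e refl → e }) d (rehead refl c)) (++-comm z (w ∷ l))
  insert-before (x ∷ l) (y ∷ z) (there w∈) c@(step Xx c′) d@(end Xy _) dis =
    [ (λ xy → cons Xx (insert-before l (y ∷ z) w∈ c′ (rehead xy d) (disjointˡ dis)))
    , (λ yx → append Xy (rehead yx c)) ]′ (compare dis)
  insert-before (x ∷ l) (y ∷ z) (there w∈) c@(step Xx c′) d@(step Xy d′) dis =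
    [ (λ xy → cons Xx (insert-before l (y ∷ z) w∈ c′ (rehead xy d) (disjointˡ dis)))
    , (λ yx → cons′ Xy (insert-before (x ∷ l) z (there w∈) (rehead yx c) d′ (disjointʳ dis))) ]′ (compare dis)

  -- Behind `w`, both `z` and the rest of `l` start at vertices dominated by `w`, so they can be
  -- merged there.
  insert-after : ∀ l z {w} → w ∈ l → Chain D X Y l → Chain D (D w) Y z → Disjoint l z →
                 Absorbed X Y l z
  insert-after _ z (here refl) (end Xx _) d dis = absorbed (step Xx d) ↭-refl
  insert-after (x ∷ l) z (here refl) (step Xx c) d dis =
    cons Xx (merge l z c d (disjointˡ dis))
  insert-after (x ∷ l) z (there w∈) (step Xx c) d dis =
    cons Xx (insert-after l z w∈ c d (disjointˡ dis))

  absorb-or-dominated′ : ∀ {r} → X r → Chain D X Y l → r ∉ l →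
                         Absorbed X Y l [ r ] ⊎ Chain D X (λ x → D x r) l
  absorb-or-dominated′ {l = x ∷ l} {r} Xr c r∉ with total (∉⇒≢ (here refl) r∉)
  ... | inj₂ rx = inj₁ (absorbed (step Xr (rehead rx c)) (∷↭∷ʳ r (x ∷ l)))
  absorb-or-dominated′ Xr (end Xx _)  r∉ | inj₁ xr = inj₂ (end Xx xr)
  absorb-or-dominated′ Xr (step Xx c) r∉ | inj₁ xr with absorb-or-dominated′ xr c (r∉ ∘ there)
  ... | inj₁ a = inj₁ (cons Xx a)
  ... | inj₂ d = inj₂ (step Xx d)

  -- If `r` dominates some vertex behind `w`, then the first such vertex has a predecessor
  -- dominating `r`, and `r` fits between the two. If not, the last vertex of `l` dominates `r`,
  -- which the end condition of the returned chain records.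
  absorb-or-dominated : ∀ {r w} → w ∈ l → D w r → Chain D X Y l → r ∉ l →
                        Absorbed X Y l [ r ] ⊎ Chain D X (λ x → D x r) l
  absorb-or-dominated (here refl) wr (end Xx _) r∉ = inj₂ (end Xx wr)
  absorb-or-dominated (here refl) wr (step Xx c) r∉ with absorb-or-dominated′ wr c (r∉ ∘ there)
  ... | inj₁ a = inj₁ (cons Xx a)
  ... | inj₂ d = inj₂ (step Xx d)
  absorb-or-dominated (there w∈) wr (step Xx c) r∉ with absorb-or-dominated w∈ wr c (r∉ ∘ there)
  ... | inj₁ a = inj₁ (cons Xx a)
  ... | inj₂ d = inj₂ (step Xx d)

  -- Either `r` dominates the first vertex of `l`, or that vertex dominates `r` and `r` fits
  -- somewhere between it and `w`.
  absorb-or-dominates : ∀ {r w} → w ∈ l → D r w → Chain D X Y l → r ∉ l →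
                        Absorbed X Y l [ r ] ⊎ Chain D (D r) Y l
  absorb-or-dominates (here refl) rw c r∉ = inj₂ (rehead rw c)
  absorb-or-dominates {l = x ∷ l} {r = r} (there w∈) rw (step Xx c) r∉ with total (∉⇒≢ (here refl) r∉)
  ... | inj₂ rx = inj₂ (step rx c)
  ... | inj₁ xr = inj₁ (cons Xx (insert-before l [ r ] w∈ c (end xr rw) λ { (v∈l , here refl) → r∉ (there v∈l) }))

  -- Systems of disjoint chains and their enlargement

  module _ {P Q : V → Set} where

    -- Applied with `P` for the vertices on the chains of a system and `Q` for the remaining ones:
    -- it yields the piece of a route before it first meets the system. `X w` is the case in which
    -- this piece is empty.
    cut-first : Chain D X Y z → Unique z → All (λ x → P x ⊎ Q x) z →
      All Q z ⊎ ∃ λ w → P w × (X w ⊎ ∃ λ z′ → Chain D X (λ x → D x w) z′ × Unique z′ × All Q z′ × All (_∈ z) z′)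
    cut-first (end Xx Yx) u (inj₁ Px ∷ []) = inj₂ (_ , Px , inj₁ Xx)
    cut-first (end Xx Yx) u (inj₂ Qx ∷ []) = inj₁ (Qx ∷ [])
    cut-first (step Xx c) u (inj₁ Px ∷ qs) = inj₂ (_ , Px , inj₁ Xx)
    cut-first (step Xx c) (x∉ ∷ u) (inj₂ Qx ∷ qs) with cut-first c u qs
    ... | inj₁ Qs = inj₁ (Qx ∷ Qs)
    ... | inj₂ (w , Pw , inj₁ xw) = inj₂ (w , Pw , inj₂ (_ , end Xx xw , [] ∷ [] , Qx ∷ [] , here refl ∷ []))
    ... | inj₂ (w , Pw , inj₂ (z′ , d , u′ , Qs , z′⊆)) =
      inj₂ (w , Pw , inj₂ (_ , step Xx d , All.map (All.lookup x∉) z′⊆ ∷ u′ , Qx ∷ Qs , here refl ∷ All.map there z′⊆))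

    cut-last : Chain D X Y z → Unique z → All (λ x → P x ⊎ Q x) z →
      All Q z ⊎ ∃ λ w → P w × (Y w ⊎ ∃ λ z′ → Chain D (D w) Y z′ × Unique z′ × All Q z′)
    cut-last (end Xx Yx) u (inj₁ Px ∷ []) = inj₂ (_ , Px , inj₁ Yx)
    cut-last (end Xx Yx) u (inj₂ Qx ∷ []) = inj₁ (Qx ∷ [])
    cut-last (step Xx c) (_ ∷ u) (q ∷ qs) with cut-last c u qs
    ... | inj₂ found = inj₂ found
    ... | inj₁ Qs with q
    ...   | inj₁ Px = inj₂ (_ , Px , inj₂ (_ , c , u , Qs))
    ...   | inj₂ Qx = inj₁ (Qx ∷ Qs)

  -- For `Vs` without repetitions, `perm` alone makes the chains simple, disjoint from each other
  -- and disjoint from `rest`.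
  record System (X Y : V → Set) (Vs : List V) (j : ℕ) : Set where
    field
      ps     : List (List V)
      rest   : List V
      chains : All (Chain D X Y) ps
      size   : length ps ≡ j
      perm   : concat ps ++ rest ↭ Vs

  open System

  Better : ∀ {Vs j} → System X Y Vs j → Set
  Better {X} {Y} {Vs} {j} s = ∃ λ (s′ : System X Y Vs j) → length (rest s′) < length (rest s)

  module _ {Vs : List V} (uVs : Unique Vs) {j : ℕ} (s : System X Y Vs j) where

    all-unique : Unique (concat (ps s) ++ rest s)
    all-unique = Unique-resp-↭ (↭-sym (perm s)) uVs

    rest-disjoint : ∀ {p v} → p ∈ ps s → v ∈ p → v ∉ rest s
    rest-disjoint p∈ v∈p v∈rest = Unique⇒Disjoint (concat (ps s)) all-unique (∈-concat⁺′ v∈p p∈ , v∈rest)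

    locate : ∀ {v} → v ∈ Vs → v ∈ concat (ps s) ⊎ v ∈ rest s
    locate v∈ = ∈-++⁻ (concat (ps s)) (∈-resp-↭ (↭-sym (perm s)) v∈)

    -- The absorbed vertices are given as `y ∷ z` because only a nonempty list makes `rest` strictly
    -- shorter.
    extend : ∀ {p y z} → p ∈ ps s → Unique (y ∷ z) → All (_∈ rest s) (y ∷ z) →
             Absorbed X Y p (y ∷ z) → Better s
    extend {p} {y} {z} p∈ u z⊆ (absorbed {l} c l↭)
      with ps′ , ps↭ ← ∈⇒↭∷ p∈
      with rest′ , rest↭ ← extract u z⊆
      = record { ps = l ∷ ps′ ; rest = rest′
               ; chains = c ∷ All.tail (All-resp-↭ ps↭ (chains s))
               ; size = ≡-trans (sym (↭-length ps↭)) (size s)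
               ; perm = ↭-trans (regroup ps′ rest′) (↭-trans (↭-sym (++⁺ (concat-resp-↭ ps↭) rest↭)) (perm s)) }
      , subst (suc (length rest′) ≤_) (sym (↭-length rest↭))
          (s≤s (subst (_ ≤_) (sym (length-++ z)) (m≤n+m (length rest′) (length z))))
      where
      open ↭-Solver
      regroup : ∀ ps′ rest′ → (l ++ concat ps′) ++ rest′ ↭ (p ++ concat ps′) ++ ((y ∷ z) ++ rest′)
      regroup ps′ rest′ = ↭-trans (++⁺ʳ rest′ (++⁺ʳ (concat ps′) l↭))
        (solve 4 (λ p z c r → ((p ⊕ z) ⊕ c) ⊕ r ⊜ (p ⊕ c) ⊕ (z ⊕ r)) ↭-refl p (y ∷ z) (concat ps′) rest′)

    extend′ : ∀ {p z} → p ∈ ps s → Chain D Z W z → Unique z → All (_∈ rest s) z →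
              (Disjoint p z → Absorbed X Y p z) → Better s
    extend′ p∈ (end _ _)  u z⊆ f = extend p∈ u z⊆ (f λ (v∈p , v∈z) → rest-disjoint p∈ v∈p (All.lookup z⊆ v∈z))
    extend′ p∈ (step _ _) u z⊆ f = extend p∈ u z⊆ (f λ (v∈p , v∈z) → rest-disjoint p∈ v∈p (All.lookup z⊆ v∈z))

    -- A route from `r` that stays in `rest` is itself a chain from `X` to `Y` and merges with `p`.
    -- Otherwise its piece before the first vertex `w` on a chain `q` can be inserted into `q`
    -- before `w`.
    absorb-from : ∀ {r p z} → p ∈ ps s → r ∈ rest s → X r →
      Chain D (_≡ r) Y z → Unique z → All (_∈ Vs) z → Better s
    absorb-from {r} {p} {z} p∈ r∈ Xr c u z⊆ with cut-first c u (All.map locate z⊆)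
    ... | inj₁ z⊆rest =
      extend′ p∈ c u z⊆rest (merge p z (All.lookup (chains s) p∈) (mapˡ (λ { refl → Xr }) c))
    ... | inj₂ (w , w∈ , inj₁ refl) = ⊥-elim (Unique⇒Disjoint (concat (ps s)) all-unique (w∈ , r∈))
    ... | inj₂ (w , w∈ , inj₂ (z′ , d , u′ , z′⊆ , _)) with q , w∈q , q∈ ← ∈-concat⁻′ (ps s) w∈ =
      extend′ q∈ d u′ z′⊆ (insert-before q z′ w∈q (All.lookup (chains s) q∈) (mapˡ (λ { refl → Xr }) d))

    -- The mirror image: the piece after the last vertex on a chain is inserted behind that vertex.
    absorb-to : ∀ {r p z} → p ∈ ps s → r ∈ rest s → Y r →
      Chain D X (_≡ r) z → Unique z → All (_∈ Vs) z → Better s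
    absorb-to {r} {p} {z} p∈ r∈ Yr c u z⊆ with cut-last c u (All.map locate z⊆)
    ... | inj₁ z⊆rest =
      extend′ p∈ c u z⊆rest (merge p z (All.lookup (chains s) p∈) (mapʳ (λ { refl → Yr }) c))
    ... | inj₂ (w , w∈ , inj₁ refl) = ⊥-elim (Unique⇒Disjoint (concat (ps s)) all-unique (w∈ , r∈))
    ... | inj₂ (w , w∈ , inj₂ (z′ , d , u′ , z′⊆)) with q , w∈q , q∈ ← ∈-concat⁻′ (ps s) w∈ =
      extend′ q∈ d u′ z′⊆ (insert-after q z′ w∈q (All.lookup (chains s) q∈) (mapʳ (λ { refl → Yr }) d))

  -- Spanning systems and Hamiltonian paths

  Spanning : (X Y : V → Set) (Vs : List V) (m : ℕ) → Set
  Spanning X Y Vs m = ∃ λ ps → length ps ≡ m × All (Chain D X Y) ps × concat ps ↭ Vs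

  merge-down : ∀ {Vs} d {m} → Unique Vs → Spanning X Y Vs (d + suc m) → Spanning X Y Vs (suc m)
  merge-down zero    u s = s
  merge-down (suc d) {m} u (p ∷ [] , len , _) = ⊥-elim (0≢d+1+m d (suc-injective len))
    where
    0≢d+1+m : ∀ d {m} → 0 ≢ d + suc m
    0≢d+1+m zero    ()
    0≢d+1+m (suc d) ()
  merge-down (suc d) u (p ∷ q ∷ ps , len , c ∷ c′ ∷ cs , ↭Vs)
    with absorbed {l} c″ l↭ ← merge p q c c′ (λ (v∈p , v∈q) →
           Unique⇒Disjoint p (Unique-resp-↭ (↭-sym ↭Vs) u) (v∈p , ∈-++⁺ˡ v∈q))
    = merge-down d u (l ∷ ps , suc-injective len , c″ ∷ cs ,
        ↭-trans (++⁺ʳ (concat ps) l↭) (↭-trans (↭-reflexive (++-assoc p q (concat ps))) ↭Vs))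

  Route : (Vs : List V) (X Y : V → Set) → Set
  Route Vs X Y = ∃ λ z → Chain D X Y z × Unique z × All (_∈ Vs) z

  module _ {X Y : V → Set} {Vs : List V} (uVs : Unique Vs)
           (covered : ∀ {r} → r ∈ Vs → X r ⊎ Y r)
           (route-to : ∀ {r} → r ∈ Vs → Route Vs (_≡ r) Y)
           (route-from : ∀ {r} → r ∈ Vs → Route Vs X (_≡ r)) where

    -- A remaining vertex satisfying `X` is absorbed along its route to `Y`, one satisfying `Y`
    -- along its route from `X`; each round shortens `rest`.
    fill : ∀ {j} (s : System X Y Vs (suc j)) → Acc _<_ (length (rest s)) → Spanning X Y Vs (suc j)
    fill record { ps = ps ; rest = [] ; chains = cs ; size = size ; perm = perm } _ =
      ps , size , cs , subst (_↭ Vs) (++-identityʳ (concat ps)) perm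
    fill s@(record { ps = _ ∷ _ ; rest = r ∷ rest ; perm = perm }) (acc rec)
      with r∈ ← ∈-resp-↭ perm (∈-++⁺ʳ (concat (ps s)) (here refl))
      with covered r∈
    ... | inj₁ Xr with z , c , u , z⊆ ← route-to r∈
                  with s′ , s′<s ← absorb-from uVs s (here refl) (here refl) Xr c u z⊆
                  = fill s′ (rec s′<s)
    ... | inj₂ Yr with z , c , u , z⊆ ← route-from r∈
                  with s′ , s′<s ← absorb-to uVs s (here refl) (here refl) Yr c u z⊆
                  = fill s′ (rec s′<s)

    route-through : ∀ {r} → r ∈ Vs → Route Vs X Y
    route-through r∈ with covered r∈
    ... | inj₁ Xr with z , c , u , z⊆ ← route-to r∈ = z , mapˡ (λ { refl → Xr }) c , u , z⊆
    ... | inj₂ Yr with z , c , u , z⊆ ← route-from r∈ = z , mapʳ (λ { refl → Yr }) c , u , z⊆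

    -- One route from `X` to `Y` is a system with a single chain, and `fill` makes it absorb all
    -- other vertices.
    hamiltonian : ∀ {r} → r ∈ Vs → ∃ λ z → Chain D X Y z × z ↭ Vs
    hamiltonian r∈
      with z , c , u , z⊆ ← route-through r∈
      with rest , Vs↭ ← extract u z⊆
      with z′ ∷ [] , refl , c′ ∷ [] , ↭Vs ←
             fill (record { ps = [ z ] ; rest = rest ; chains = c ∷ [] ; size = refl
                          ; perm = subst (λ l → l ++ rest ↭ Vs) (sym (++-identityʳ z)) (↭-sym Vs↭) })
                  (<-wellFounded _)
      = z′ , c′ , subst (_↭ Vs) (++-identityʳ z′) ↭Vs

  -- Linking chains through a path on the remaining vertices

  scan : ∀ {Iᵃ Oᵃ Iᵇ Oᵇ : V → Set} → Chain D X Y z →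
    All (λ x → (Iᵃ x ⊎ Oᵃ x) × (Iᵇ x ⊎ Oᵇ x)) z →
    Chain D Iᵃ Y z ⊎ Chain D Iᵇ Y z ⊎ Chain D X Oᵃ z ⊎
    ∃₂ λ z₁ z₂ → z ≡ z₁ ++ z₂ × (Chain D X Oᵃ z₁ × Chain D Iᵇ Y z₂ ⊎ Chain D X Oᵇ z₁ × Chain D Iᵃ Y z₂)
  scan c ((inj₁ Ix , _) ∷ _)           = inj₁ (rehead Ix c)
  scan c ((inj₂ _ , inj₁ Ix) ∷ _)      = inj₂ (inj₁ (rehead Ix c))
  scan (end Xx _)  ((inj₂ Ox , inj₂ _) ∷ _) = inj₂ (inj₂ (inj₁ (end Xx Ox)))
  -- Here `x` satisfies both `Oᵃ` and `Oᵇ`. If the next vertex satisfies `Iᵃ` or `Iᵇ`, the cut is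
  -- made right behind `x`, which contributes the `O` of the other letter. If no vertex does, the
  -- last one satisfies `Oᵃ`.
  scan (step Xx c) ((inj₂ Oᵃx , inj₂ Oᵇx) ∷ ds) with scan c ds
  ... | inj₁ d               = inj₂ (inj₂ (inj₂ (_ , _ , refl , inj₂ (end Xx Oᵇx , d))))
  ... | inj₂ (inj₁ d)        = inj₂ (inj₂ (inj₂ (_ , _ , refl , inj₁ (end Xx Oᵃx , d))))
  ... | inj₂ (inj₂ (inj₁ d)) = inj₂ (inj₂ (inj₁ (step Xx d)))
  ... | inj₂ (inj₂ (inj₂ (z₁ , z₂ , refl , inj₁ (d , e)))) =
    inj₂ (inj₂ (inj₂ (_ , z₂ , refl , inj₁ (step Xx d , e))))
  ... | inj₂ (inj₂ (inj₂ (z₁ , z₂ , refl , inj₂ (d , e)))) =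
    inj₂ (inj₂ (inj₂ (_ , z₂ , refl , inj₂ (step Xx d , e))))

  module Linking (X Y : V → Set) where

    -- The last vertex of `p` dominates `r`, respectively `r` dominates the first vertex of `p`.
    -- Stated as chains over `p`, these facts can be passed directly to `join`.
    In Out : List V → V → Set
    In  p r = Chain D X (λ x → D x r) p
    Out p r = Chain D (D r) Y p

    attach-front : ∀ {p} → Chain D (In p) Z z → Chain D X Z (p ++ z)
    attach-front c with r , p→r , c′ ← head-of c = join (λ { e refl → e }) p→r c′

    attach-back : ∀ {p} → Chain D Z (Out p) z → Chain D Z Y (z ++ p)
    attach-back c with r , r→p , c′ ← last-of c = join (λ { refl e → e }) c′ r→p

    link : ∀ {p q} → Chain D (In p) (Out q) z → Chain D X Y ((p ++ z) ++ q)
    link c = attach-back (attach-front c)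

    module _ {ps : List (List V)} (cs : All (Chain D X Y) ps) where

      combine₂ : ∀ {p q ps′ m} → ps ↭ p ∷ q ∷ ps′ → length ps ≡ suc (suc m) →
        Chain D (In p) (Out q) z → Spanning X Y (concat ps ++ z) (suc m)
      combine₂ {z = z} {p} {q} {ps′} ps↭ len c =
        ((p ++ z) ++ q) ∷ ps′ ,
        suc-injective (≡-trans (sym (↭-length ps↭)) len) ,
        link c ∷ All.tail (All.tail (All-resp-↭ ps↭ cs)) ,
        ↭-trans (solve 4 (λ p z q c → ((p ⊕ z) ⊕ q) ⊕ c ⊜ (p ⊕ (q ⊕ c)) ⊕ z) ↭-refl p z q (concat ps′))
          (++⁺ʳ z (↭-sym (concat-resp-↭ ps↭)))
        where open ↭-Solver

      -- The new chain is `b z₂ p z₁ a`. It is possible because `p` can be entered from `s`, the end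
      -- of `z₂`, and left towards `r`, the start of `z₁`.
      combine₃ : ∀ {p a b ps′ m r s z₁ z₂} → ps ↭ p ∷ a ∷ b ∷ ps′ → length ps ≡ suc (suc (suc m)) →
        In p r → Out p s → Chain D (_≡ r) (Out a) z₁ → Chain D (In b) (_≡ s) z₂ →
        Spanning X Y (concat ps ++ (z₁ ++ z₂)) (suc m)
      combine₃ {p} {a} {b} {ps′} {z₁ = z₁} {z₂} ps↭ len p→r s→p c₁ c₂ =
        (((b ++ z₂) ++ p) ++ (z₁ ++ a)) ∷ ps′ ,
        suc-injective (suc-injective (≡-trans (sym (↭-length ps↭)) len)) ,
        join (λ { e refl → e }) (join (λ { refl e → e }) (attach-front c₂) (cross s→p p→r)) (attach-back c₁)
          ∷ All.tail (All.tail (All.tail (All-resp-↭ ps↭ cs))) ,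
        ↭-trans (solve 6 (λ p a b z₁ z₂ c → (((b ⊕ z₂) ⊕ p) ⊕ (z₁ ⊕ a)) ⊕ c ⊜ (p ⊕ (a ⊕ (b ⊕ c))) ⊕ (z₁ ⊕ z₂))
                  ↭-refl p a b z₁ z₂ (concat ps′))
          (++⁺ʳ (z₁ ++ z₂) (↭-sym (concat-resp-↭ ps↭)))
        where open ↭-Solver

      combine : ∀ {m} → length ps ≡ suc (suc (suc m)) →
        All (λ r → All (λ p → In p r ⊎ Out p r) ps) z →
        Chain D (λ r → Any (λ p → In p r) ps) (λ r → Any (λ p → Out p r) ps) z →
        Spanning X Y (concat ps ++ z) (suc (suc m)) ⊎ Spanning X Y (concat ps ++ z) (suc m)
      combine len dich c
        with r , Er , c₁ ← head-of c
        with s , Fs , c₂ ← last-of c₁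
        with p , p∈ , p→r ← find Er
        with ps₁ , ps↭ ← ∈⇒↭∷ p∈
        with Any-resp-↭ ps↭ Fs
      -- The path ends at a chain other than `p`, so it links two different chains.
      ... | there Fs′
        with q , q∈ , s→q ← find Fs′
        with ps₂ , ps₁↭ ← ∈⇒↭∷ q∈
        = inj₁ (combine₂ (↭-trans ps↭ (prep p ps₁↭)) len
            (mapˡ (λ { refl → p→r }) (mapʳ (λ { refl → s→q }) c₂)))
      ... | here s→p with ps₁ | ps↭ | ≡-trans (sym (↭-length ps↭)) len
      -- The path leads from `p` back to `p`; having at least three chains provides `a` and `b`. The
      -- first three outcomes of `scan` link `p` with `a` or `b` through the whole path, the last
      -- two cut the path.
      ...   | a ∷ b ∷ ps₂ | ps↭ | _
        with scan c₂ (All.map (λ ds → case All-resp-↭ ps↭ ds of λ { (_ ∷ da ∷ db ∷ _) → da , db }) dich)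
      ...     | inj₁ d =
        inj₁ (combine₂ (↭-trans ps↭ (swap p a ↭-refl)) len (mapʳ (λ { refl → s→p }) d))
      ...     | inj₂ (inj₁ d) =
        inj₁ (combine₂ (↭-trans ps↭ (↭-trans (prep p (swap a b ↭-refl)) (swap p b ↭-refl))) len
          (mapʳ (λ { refl → s→p }) d))
      ...     | inj₂ (inj₂ (inj₁ d)) =
        inj₁ (combine₂ ps↭ len (mapˡ (λ { refl → p→r }) d))
      ...     | inj₂ (inj₂ (inj₂ (z₁ , z₂ , refl , inj₁ (d , e)))) =
        inj₂ (combine₃ ps↭ len p→r s→p d e)
      ...     | inj₂ (inj₂ (inj₂ (z₁ , z₂ , refl , inj₂ (d , e)))) =
        inj₂ (combine₃ (↭-trans ps↭ (prep p (swap a b ↭-refl))) len p→r s→p d e)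

  -- Saturated systems and the reduction in the number of chains

  module _ (asym : ∀ {x y} → D x y → ¬ D y x) {Vs : List V} (uVs : Unique Vs)
           (route : ∀ {x y} → x ∈ Vs → y ∈ Vs → Route Vs (_≡ x) (_≡ y)) where

    module _ {X Y : V → Set} {j : ℕ} (s : System X Y Vs (suc j)) where

      open Linking X Y

      Saturated : Set
      Saturated = All (λ r → All (λ p → All (λ w → (D w r → In p r) × (D r w → Out p r)) p) (ps s)) (rest s)

      saturated? : Better s ⊎ Saturated
      saturated? = all-or (rest s) λ r∈ → all-or (ps s) λ p∈ → all-or _ λ w∈ → check r∈ p∈ w∈
        where
        check : ∀ {r p w} → r ∈ rest s → p ∈ ps s → w ∈ p →
                Better s ⊎ ((D w r → In p r) × (D r w → Out p r))
        check {r} {p} {w} r∈ p∈ w∈ = [ from-w , to-w ]′ (total (∉⇒≢ w∈ r∉p))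
          where
          r∉p : r ∉ p
          r∉p r∈p = rest-disjoint uVs s p∈ r∈p r∈
          insert : Absorbed X Y p [ r ] → Better s
          insert = extend uVs s p∈ ([] ∷ []) (r∈ ∷ [])
          from-w : D w r → Better s ⊎ ((D w r → In p r) × (D r w → Out p r))
          from-w wr with absorb-or-dominated w∈ wr (All.lookup (chains s) p∈) r∉p
          ... | inj₁ a = inj₁ (insert a)
          -- The second implication is vacuous, as the arc from `w` to `r` excludes its reverse.
          ... | inj₂ i = inj₂ ((λ _ → i) , (λ rw → ⊥-elim (asym wr rw)))
          to-w : D r w → Better s ⊎ ((D w r → In p r) × (D r w → Out p r))
          to-w rw with absorb-or-dominates w∈ rw (All.lookup (chains s) p∈) r∉p
          ... | inj₁ a = inj₁ (insert a)
          ... | inj₂ o = inj₂ ((λ wr → ⊥-elim (asym wr rw)) , (λ _ → o))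

      module _ (saturated : Saturated) where

        E F : V → Set
        E r = Any (λ p → In p r) (ps s)
        F r = Any (λ p → Out p r) (ps s)

        nonempty : ∃ λ p → p ∈ ps s
        nonempty with ps s | size s
        ... | p ∷ _ | _ = p , here refl

        some-vertex : ∃₂ λ p w → p ∈ ps s × w ∈ p
        some-vertex with p , p∈ ← nonempty with All.lookup (chains s) p∈
        ... | end _ _  = _ , _ , p∈ , here refl
        ... | step _ _ = _ , _ , p∈ , here refl

        ps⊆Vs : ∀ {p w} → p ∈ ps s → w ∈ p → w ∈ Vs
        ps⊆Vs p∈ w∈ = ∈-resp-↭ (perm s) (∈-++⁺ˡ (∈-concat⁺′ w∈ p∈))

        rest⊆Vs : ∀ {r} → r ∈ rest s → r ∈ Vs
        rest⊆Vs r∈ = ∈-resp-↭ (perm s) (∈-++⁺ʳ (concat (ps s)) r∈)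

        in-or-out : ∀ {r} → r ∈ rest s → All (λ p → In p r ⊎ Out p r) (ps s)
        in-or-out {r} r∈ = All.tabulate λ p∈ → decide p∈ (All.lookup (chains s) p∈)
          where
          decide : ∀ {p} → p ∈ ps s → Chain D X Y p → In p r ⊎ Out p r
          decide {x ∷ _} p∈ _
            with f , g ← All.lookup (All.lookup (All.lookup saturated r∈) p∈) (here refl)
            with total (∉⇒≢ (here refl) (λ r∈p → rest-disjoint uVs s p∈ r∈p r∈))
          ... | inj₁ xr = inj₁ (f xr)
          ... | inj₂ rx = inj₂ (g rx)

        E-or-F : ∀ {r} → r ∈ rest s → E r ⊎ F r
        E-or-F r∈ with p , p∈ ← nonempty with All.lookup (in-or-out r∈) p∈
        ... | inj₁ i = inj₁ (lose p∈ i)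
        ... | inj₂ o = inj₂ (lose p∈ o)

        -- A route from `r` to any vertex on a chain is cut where it first meets a chain `q`. The
        -- vertex just before dominates a vertex of `q`, hence by saturation the first vertex of
        -- `q`.
        route-to-F : ∀ {r} → r ∈ rest s → Route (rest s) (_≡ r) F
        route-to-F r∈
          with p , w , p∈ , w∈ ← some-vertex
          with z , c , u , z⊆ ← route (rest⊆Vs r∈) (ps⊆Vs p∈ w∈)
          with cut-first c u (All.map (locate uVs s) z⊆)
        ... | inj₁ z⊆rest = ⊥-elim (rest-disjoint uVs s p∈ w∈ (All.lookup z⊆rest (last-∈ c)))
        ... | inj₂ (v , v∈ , inj₁ refl) = ⊥-elim (Unique⇒Disjoint _ (all-unique uVs s) (v∈ , r∈))
        ... | inj₂ (v , v∈ , inj₂ (z′ , d , u′ , z′⊆ , _))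
          with y , yv , d′ ← last-of d
          with q , v∈q , q∈ ← ∈-concat⁻′ (ps s) v∈
          = z′ , mapʳ (λ { refl → lose q∈ (proj₂ (All.lookup (All.lookup (All.lookup saturated
                   (All.lookup z′⊆ (last-∈ d′))) q∈) v∈q) yv) }) d′ , u′ , z′⊆

        route-from-E : ∀ {r} → r ∈ rest s → Route (rest s) E (_≡ r)
        route-from-E r∈
          with p , w , p∈ , w∈ ← some-vertex
          with z , c , u , z⊆ ← route (ps⊆Vs p∈ w∈) (rest⊆Vs r∈)
          with cut-last c u (All.map (locate uVs s) z⊆)
        ... | inj₁ z⊆rest = ⊥-elim (rest-disjoint uVs s p∈ w∈ (All.lookup z⊆rest (head-∈ c)))
        ... | inj₂ (v , v∈ , inj₁ refl) = ⊥-elim (Unique⇒Disjoint _ (all-unique uVs s) (v∈ , r∈))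
        ... | inj₂ (v , v∈ , inj₂ (z′ , d , u′ , z′⊆))
          with y , vy , d′ ← head-of d
          with q , v∈q , q∈ ← ∈-concat⁻′ (ps s) v∈
          = z′ , mapˡ (λ { refl → lose q∈ (proj₁ (All.lookup (All.lookup (All.lookup saturated
                   (All.lookup z′⊆ (head-∈ d′))) q∈) v∈q) vy) }) d′ , u′ , z′⊆

    module _ {X Y : V → Set} {m : ℕ} where

      open Linking X Y using (combine)

      -- Single vertices are inserted as long as this shortens `rest`. Linking then costs one or two
      -- chains, or none if nothing remains, and `merge-down` removes the surplus.
      span : (s : System X Y Vs (suc (suc (suc m)))) → Acc _<_ (length (rest s)) → Spanning X Y Vs (suc m)
      span s (acc rec) with saturated? s
      ... | inj₁ (s′ , s′<s) = span s′ (rec s′<s)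
      ... | inj₂ sat with empty-or-∈ (rest s)
      ...   | inj₁ eq = merge-down 2 uVs (ps s , size s , chains s ,
                     subst (_↭ Vs) (≡-trans (cong (concat (ps s) ++_) eq) (++-identityʳ _)) (perm s))
      ...   | inj₂ (_ , r∈)
        -- The Hamiltonian path is taken on `rest` alone, with `E` and `F` as start and end
        -- conditions.
        with z , c , z↭ ← hamiltonian (Unique-++⁻ʳ (concat (ps s)) (all-unique uVs s))
               (E-or-F s sat) (route-to-F s sat) (route-from-E s sat) r∈
        with combine (chains s) (size s)
               (All.tabulate (λ x∈z → in-or-out s sat (∈-resp-↭ z↭ x∈z))) c
      ...     | inj₁ (ps′ , len , cs , perm′) = merge-down 1 uVs (ps′ , len , cs , ↭-trans perm′ (↭-trans (++⁺ˡ _ z↭) (perm s)))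
      ...     | inj₂ (ps′ , len , cs , perm′) = ps′ , len , cs , ↭-trans perm′ (↭-trans (++⁺ˡ _ z↭) (perm s))

-- Tournaments on Fin n

split-first : ∀ {D : Digraph V} {x Y l} → Chain D (_≡ x) Y l →
              Y x ⊎ ∃ λ l′ → Chain D (D x) Y l′ × l ≡ x ∷ l′
split-first (end refl Yx) = inj₁ Yx
split-first (step refl c) = inj₂ (_ , c , refl)

split-last : ∀ {D : Digraph V} {X y l} → Chain D X (_≡ y) l →
             (X y × l ≡ [ y ]) ⊎ ∃ λ l′ → Chain D X (λ x → D x y) l′ × l ≡ l′ ∷ʳ y
split-last (end Xy refl) = inj₁ (Xy , refl)
split-last (step {x = x} Xx c) with split-last c
... | inj₁ (xy , refl)      = inj₂ ([ x ] , end Xx xy , refl)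
... | inj₂ (l′ , c′ , refl) = inj₂ (x ∷ l′ , step Xx c′ , refl)

restrict : ∀ {D : Digraph V} {P X Y : V → Set} {l} → All P l → Chain D X Y l →
           Chain (λ x y → D x y × P x × P y) (λ x → X x × P x) (λ y → Y y × P y) l
restrict (Px ∷ []) (end Xx Yx) = end (Xx , Px) (Yx , Px)
restrict (Px ∷ Ps) (step Xx c) = step (Xx , Px) (mapˡ (λ (d , Py) → d , Px , Py) (restrict Ps c))

chain-all : ∀ {D : Digraph V} {P X Y : V → Set} {l} → (∀ {x} → X x → P x) → (∀ {x y} → D x y → P y) →
            Chain D X Y l → All P l
chain-all f g (end Xx _)  = f Xx ∷ []
chain-all f g (step Xx c) = f Xx ∷ chain-all g g c

∣⁅x⁆∪p∣≤1+∣p∣ : ∀ {n} (x : Fin n) (p : Subset n) → ∣ ⁅ x ⁆ ∪ p ∣ ≤ suc ∣ p ∣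
∣⁅x⁆∪p∣≤1+∣p∣ zero    (inside  Vec.∷ p) = s≤s (≤-trans (≤-reflexive (cong ∣_∣ (∪-identityˡ p))) (m≤n+m _ 1))
∣⁅x⁆∪p∣≤1+∣p∣ zero    (outside Vec.∷ p) = s≤s (≤-reflexive (cong ∣_∣ (∪-identityˡ p)))
∣⁅x⁆∪p∣≤1+∣p∣ (suc x) (inside  Vec.∷ p) = s≤s (∣⁅x⁆∪p∣≤1+∣p∣ x p)
∣⁅x⁆∪p∣≤1+∣p∣ (suc x) (outside Vec.∷ p) = ∣⁅x⁆∪p∣≤1+∣p∣ x p

toSubset : ∀ {n} → List (Fin n) → Subset n
toSubset = foldr (λ x p → ⁅ x ⁆ ∪ p) ∅

∣toSubset∣≤length : ∀ {n} (S : List (Fin n)) → ∣ toSubset S ∣ ≤ length S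
∣toSubset∣≤length {n} []  = ≤-reflexive (∣⊥∣≡0 n)
∣toSubset∣≤length (x ∷ S) = ≤-trans (∣⁅x⁆∪p∣≤1+∣p∣ x (toSubset S)) (s≤s (∣toSubset∣≤length S))

∈-toSubset⁺ : ∀ {n} {x : Fin n} {S} → x ∈ S → x ∈ₛ toSubset S
∈-toSubset⁺ (here refl) = x∈p∪q⁺ (inj₁ (x∈⁅x⁆ _))
∈-toSubset⁺ (there x∈)  = x∈p∪q⁺ (inj₂ (∈-toSubset⁺ x∈))

∈-toSubset⁻ : ∀ {n} {x : Fin n} S → x ∈ₛ toSubset S → x ∈ S
∈-toSubset⁻ []      x∈ = ⊥-elim (∉⊥ x∈)
∈-toSubset⁻ (y ∷ S) x∈ with x∈p∪q⁻ ⁅ y ⁆ (toSubset S) x∈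
... | inj₁ x∈y = here (x∈⁅y⁆⇒x≡y y x∈y)
... | inj₂ x∈S = there (∈-toSubset⁻ S x∈S)

module _ {n : ℕ} {T : Digraph (Fin n)} where

  walk⇒chain : ∀ {S} {x y : ∃ (_∈ₛ ∁ S)} (w : Star (delete T S) x y) →
               Chain T (_≡ proj₁ x) (_≡ proj₁ y) (map proj₁ (vertices w))
  walk⇒chain ε       = end refl refl
  walk⇒chain (d ◅ w) = step refl (mapˡ (λ { refl → d }) (walk⇒chain w))

  strong⇒route : ∀ {m} → IsStrong m T → ∀ {x y} S → length S < m → x ∉ S → y ∉ S →
                 ∃ λ l → Chain T (_≡ x) (_≡ y) l × Unique l × All (_∉ S) l
  strong⇒route strong {x} {y} S S<m x∉ y∉
    with mkPath w u ← IsStrong.robust strong (toSubset S) (≤-<-trans (∣toSubset∣≤length S) S<m)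
           (x , x∉p⇒x∈∁p (x∉ ∘ ∈-toSubset⁻ S)) (y , x∉p⇒x∈∁p (y∉ ∘ ∈-toSubset⁻ S))
    = _ , walk⇒chain w , Uniqueₚ.map⁺ injective u ,
      Allₚ.map⁺ (All.universal (λ (_ , v∈) v∈S → x∈∁p⇒x∉p v∈ (∈-toSubset⁺ v∈S)) (vertices w))
    where
    injective : ∀ {a b : ∃ (_∈ₛ ∁ (toSubset S))} → proj₁ a ≡ proj₁ b → a ≡ b
    injective {_ , p} {_ , q} refl = cong (_ ,_) ([]=-irrelevant p q)

-- Containers from chains

∈-lookup⇒∈-concat : ∀ (ps : List (List V)) i {x} → x ∈ lookup ps i → x ∈ concat ps
∈-lookup⇒∈-concat ps i x∈ = ∈-concat⁺′ x∈ (∈-lookup {xs = ps} i)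

lookup-disjoint : ∀ (ps : List (List V)) → Unique (concat ps) → ∀ {i j} → i ≢ j →
                  Disjoint (lookup ps i) (lookup ps j)
lookup-disjoint (p ∷ ps) u {zero}  {zero}  i≢j _ = i≢j refl
lookup-disjoint (p ∷ ps) u {zero}  {suc j} i≢j (v∈ , v∈′) =
  Unique⇒Disjoint p u (v∈ , ∈-lookup⇒∈-concat ps j v∈′)
lookup-disjoint (p ∷ ps) u {suc i} {zero}  i≢j (v∈ , v∈′) =
  Unique⇒Disjoint p u (v∈′ , ∈-lookup⇒∈-concat ps i v∈)
lookup-disjoint (p ∷ ps) u {suc i} {suc j} i≢j v∈ =
  lookup-disjoint ps (Unique-++⁻ʳ p u) (i≢j ∘ cong suc) v∈

chain⇒walk : ∀ {D : Digraph V} {u v l} → Chain D (D u) (λ x → D x v) l →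
             ∃ λ (w : Star D u v) → vertices w ≡ u ∷ l ∷ʳ v
chain⇒walk (end ux xv) = ux ◅ xv ◅ ε , refl
chain⇒walk (step ux c) with w , eq ← chain⇒walk c = ux ◅ w , cong (_ ∷_) eq

module _ {D : Digraph V} {u v : V} (u≢v : u ≢ v) where

  chain⇒path : ∀ {l} → Chain D (D u) (λ x → D x v) l → Unique l → All (λ x → x ≢ u × x ≢ v) l →
               ∃ λ (p : Path D u v) → pathVertices p ≡ u ∷ l ∷ʳ v
  chain⇒path c ul ∉l with w , eq ← chain⇒walk c =
    mkPath w (subst Unique (sym eq)
      (Allₚ.∷ʳ⁺ (All.map (≢-sym ∘ proj₁) ∉l) u≢v ∷
       Uniqueₚ.++⁺ ul ([] ∷ []) λ { (x∈l , here refl) → proj₂ (All.lookup ∉l x∈l) refl })) , eq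

  -- The index `i₀` selects a path that witnesses the covering of `u` and `v` themselves.
  chains⇒container : ∀ {Vs} (ps : List (List V)) → All (Chain D (D u) (λ x → D x v)) ps →
    Unique (concat ps) → concat ps ↭ Vs → (∀ {x} → x ∈ Vs → x ≢ u × x ≢ v) →
    (∀ x → x ≡ u ⊎ x ≡ v ⊎ x ∈ Vs) → Fin (length ps) → Container D (length ps) u v
  chains⇒container ps cs ups ps↭ ∉Vs cover i₀ = record
    { path               = λ i → proj₁ (path i)
    ; distinct           = distinct
    ; internallyDisjoint = disjoint
    ; spanning           = spanning
    }
    where
    chain : ∀ i → Chain D (D u) (λ x → D x v) (lookup ps i)
    chain i = All.lookup cs (∈-lookup i)

    interior : ∀ i {x} → x ∈ lookup ps i → x ≢ u × x ≢ v
    interior i x∈ = ∉Vs (∈-resp-↭ ps↭ (∈-lookup⇒∈-concat ps i x∈))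

    unique-member : ∀ (qs : List (List V)) → Unique (concat qs) → ∀ i → Unique (lookup qs i)
    unique-member (q ∷ qs) uq zero    = Unique-++⁻ˡ q uq
    unique-member (q ∷ qs) uq (suc i) = unique-member qs (Unique-++⁻ʳ q uq) i

    path : ∀ i → ∃ λ (p : Path D u v) → pathVertices p ≡ u ∷ lookup ps i ∷ʳ v
    path i = chain⇒path (chain i) (unique-member ps ups i) (All.tabulate (interior i))

    locate-vertex : ∀ i {x} → x ∈ pathVertices (proj₁ (path i)) → (x ≡ u ⊎ x ≡ v) ⊎ x ∈ lookup ps i
    locate-vertex i {x} x∈ with subst (x ∈_) (proj₂ (path i)) x∈
    ... | here eq = inj₁ (inj₁ eq)
    ... | there x∈′ with ∈-++⁻ (lookup ps i) x∈′
    ...   | inj₁ x∈l       = inj₂ x∈l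
    ...   | inj₂ (here eq) = inj₁ (inj₂ eq)

    disjoint : ∀ i j → i ≢ j → ∀ x → x ∈ pathVertices (proj₁ (path i)) →
               x ∈ pathVertices (proj₁ (path j)) → x ≡ u ⊎ x ≡ v
    disjoint i j i≢j x x∈i x∈j with locate-vertex i x∈i | locate-vertex j x∈j
    ... | inj₁ eq | _       = eq
    ... | inj₂ _  | inj₁ eq = eq
    ... | inj₂ a  | inj₂ b  = ⊥-elim (lookup-disjoint ps ups i≢j (a , b))

    inner : ∀ i {x} → x ∈ lookup ps i → x ∈ pathVertices (proj₁ (path i))
    inner i x∈ = subst (_ ∈_) (sym (proj₂ (path i))) (there (∈-++⁺ˡ x∈))

    distinct : ∀ i j → i ≢ j → pathVertices (proj₁ (path i)) ≢ pathVertices (proj₁ (path j))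
    distinct i j i≢j eq
      with x , _ , c ← head-of (chain i)
      with x≢u , x≢v ← interior i (head-∈ c)
      -- Chains are nonempty, so each path has an inner vertex; equal paths would share it, against
      -- disjointness.
      = [ x≢u , x≢v ]′ (disjoint i j i≢j x (inner i (head-∈ c)) (subst (x ∈_) eq (inner i (head-∈ c))))

    spanning : ∀ x → ∃ λ i → x ∈ pathVertices (proj₁ (path i))
    spanning x with cover x
    ... | inj₁ refl = i₀ , subst (x ∈_) (sym (proj₂ (path i₀))) (here refl)
    ... | inj₂ (inj₁ refl) = i₀ , subst (x ∈_) (sym (proj₂ (path i₀))) (there (∈-++⁺ʳ (lookup ps i₀) (here refl)))
    ... | inj₂ (inj₂ x∈Vs) with any ← ∈-concat⁻ ps (∈-resp-↭ (↭-sym ps↭) x∈Vs) =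
      Any.index any , inner (Any.index any) (lookup-index any)

-- Containers in strong tournaments

module _ {n : ℕ} {T : Digraph (Fin n)} (tournament : IsTournament T) where

  open IsTournament tournament

  total : ∀ {x y} → x ≢ y → T x y ⊎ T y x
  total {x} {y} x≢y = [ inj₁ ∘ proj₁ , inj₂ ∘ proj₁ ]′ (exactlyOneArc x y x≢y)

  asym : ∀ {x y} → T x y → ¬ T y x
  asym {x} {y} xy yx with x Fin.≟ y
  ... | yes refl = loopless x xy
  ... | no x≢y = [ (λ (_ , ¬yx) → ¬yx yx) , (λ (_ , ¬xy) → ¬xy xy) ]′ (exactlyOneArc x y x≢y)

  arc? : ∀ x y → Dec (T x y)
  arc? x y with x Fin.≟ y
  ... | yes refl = no (loopless x)
  ... | no x≢y = [ (λ (xy , _) → yes xy) , (λ (_ , ¬xy) → no ¬xy) ]′ (exactlyOneArc x y x≢y)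

  module _ {u v : Fin n} (u≢v : u ≢ v) (vu : T v u) where

    inner? : Decidable₁ λ x → x ≢ u × x ≢ v
    inner? x = ¬? (x Fin.≟ u) ×-dec ¬? (x Fin.≟ v)

    Vs : List (Fin n)
    Vs = filter inner? (allFin n)

    Vs-unique : Unique Vs
    Vs-unique = Uniqueₚ.filter⁺ inner? (Uniqueₚ.allFin⁺ n)

    ∈-Vs⁺ : ∀ {x} → x ≢ u → x ≢ v → x ∈ Vs
    ∈-Vs⁺ x≢u x≢v = ∈-filter⁺ inner? (∈-allFin _) (x≢u , x≢v)

    ∈-Vs⁻ : ∀ {x} → x ∈ Vs → x ≢ u × x ≢ v
    ∈-Vs⁻ x∈ = proj₂ (∈-filter⁻ inner? {xs = allFin n} x∈)

    Vs-cover : ∀ x → x ≡ u ⊎ x ≡ v ⊎ x ∈ Vs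
    Vs-cover x with x Fin.≟ u | x Fin.≟ v
    ... | yes eq | _      = inj₁ eq
    ... | no _   | yes eq = inj₂ (inj₁ eq)
    ... | no x≢u | no x≢v = inj₂ (inj₂ (∈-Vs⁺ x≢u x≢v))

    E : List (Fin n × Fin n)
    E = filter (λ (x , y) → arc? x y) (cartesianProduct Vs Vs)

    A B : List (Fin n)
    A = filter (arc? u) Vs
    B = filter (λ x → arc? x v) Vs

    ∈-E⁻ : ∀ {x y} → (x , y) ∈ E → T x y × y ∈ Vs
    ∈-E⁻ xy∈ with xy∈′ , xy ← ∈-filter⁻ (λ (x , y) → arc? x y) {xs = cartesianProduct Vs Vs} xy∈ =
      xy , proj₂ (∈-cartesianProduct⁻ Vs Vs xy∈′)

    ∈-E⁺ : ∀ {x y} → T x y × x ∈ Vs × y ∈ Vs → (x , y) ∈ E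
    ∈-E⁺ (xy , x∈ , y∈) = ∈-filter⁺ (λ (x , y) → arc? x y) (∈-cartesianProduct⁺ x∈ y∈) xy

    -- With the arc directed from `v` to `u`, a path from `u` to `v` has an inner vertex, and
    -- dropping both ends leaves a chain from `A` to `B`.
    inner-route : ∀ {m} → IsStrong m T → ∀ S → length S < m → All (_∈ Vs) S →
                  ∃ λ l → Chain (Arc E) (_∈ A) (_∈ B) l × All (_∉ S) l × All (_∈ Vs) l
    inner-route strong S S<m S⊆
      with l , c , ul , ∉S ← strong⇒route strong {u} {v} S S<m
             (λ u∈ → proj₁ (∈-Vs⁻ (All.lookup S⊆ u∈)) refl) (λ v∈ → proj₂ (∈-Vs⁻ (All.lookup S⊆ v∈)) refl)
      with split-first c
    ... | inj₁ u≡v = ⊥-elim (u≢v u≡v)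
    ... | inj₂ (l₁ , c₁ , refl) with split-last c₁
    ...   | inj₁ (uv , _) = ⊥-elim (asym uv vu)
    ...   | inj₂ (l₂ , c₂ , refl)
      with u∉ ∷ ul₁ ← ul
      = l₂ ,
        mapˡ (λ (ux , x∈) → ∈-filter⁺ (arc? u) x∈ ux)
          (mapʳ (λ (xv , x∈) → ∈-filter⁺ (λ x → arc? x v) x∈ xv) (map-arcs ∈-E⁺ (restrict l₂⊆ c₂))) ,
        Allₚ.++⁻ˡ l₂ (All.tail ∉S) , l₂⊆
      where
      l₂⊆ : All (_∈ Vs) l₂
      l₂⊆ = All.tabulate λ x∈ → ∈-Vs⁺
        (λ { refl → All.lookup u∉ (∈-++⁺ˡ x∈) refl })
        (λ { refl → Unique⇒Disjoint l₂ ul₁ (x∈ , here refl) })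

    open Semicomplete {D = T} total using (System; Route; span)

    initial-system : ∀ {m j} → IsStrong m T → j ≤ m → System (T u) (λ x → T x v) Vs j
    initial-system {m} {j} strong j≤m with menger Fin._≟_ E A B j
    ... | inj₁ (S , S<j , sep)
      -- `u` and `v` must survive the deletion, so they are removed from `S`. The route runs within
      -- `Vs` and hence misses all of `S`, contradicting separation.
      with l , c , ∉S , l⊆ ← inner-route strong (filter inner? S)
             (≤-<-trans (length-filter inner? S) (<-≤-trans S<j j≤m))
             (All.tabulate λ x∈ → case ∈-filter⁻ inner? {xs = S} x∈ of λ (_ , x≢u , x≢v) → ∈-Vs⁺ x≢u x≢v)
      with x , x∈l , x∈S ← sep c
      = ⊥-elim (All.lookup ∉S x∈l (∈-filter⁺ inner? x∈S (∈-Vs⁻ (All.lookup l⊆ x∈l))))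
    ... | inj₂ (ps , |ps| , cs , ups)
      with rest , Vs↭ ← extract ups (Allₚ.concat⁺ (All.map
             (chain-all (λ x∈A → proj₁ (∈-filter⁻ (arc? u) {xs = Vs} x∈A)) (proj₂ ∘ ∈-E⁻)) cs))
      = record
        { ps = ps ; rest = rest ; size = |ps| ; perm = ↭-sym Vs↭
        ; chains = All.map (λ c → mapˡ (λ x∈A → proj₂ (∈-filter⁻ (arc? u) {xs = Vs} x∈A))
            (mapʳ (λ x∈B → proj₂ (∈-filter⁻ (λ x → arc? x v) {xs = Vs} x∈B)) (map-arcs (proj₁ ∘ ∈-E⁻) c))) cs }

    Vs-avoids-ends : ∀ {x} → x ∈ Vs → x ∉ u ∷ v ∷ []
    Vs-avoids-ends x∈ (here eq)         = proj₁ (∈-Vs⁻ x∈) eq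
    Vs-avoids-ends x∈ (there (here eq)) = proj₂ (∈-Vs⁻ x∈) eq

    route : ∀ {m} → IsStrong m T → 2 < m → ∀ {x y} → x ∈ Vs → y ∈ Vs → Route Vs (_≡ x) (_≡ y)
    route strong 2<m x∈ y∈
      with l , c , ul , ∉S ← strong⇒route strong (u ∷ v ∷ []) 2<m (Vs-avoids-ends x∈) (Vs-avoids-ends y∈)
      = l , c , ul , All.map (λ x∉ → ∈-Vs⁺ (x∉ ∘ here) (x∉ ∘ there ∘ here)) ∉S

    -- Two chains beyond the desired number are requested from Menger's theorem, since linking may
    -- use up two.
    container : ∀ {m j} → IsStrong m T → 2 + suc j ≤ m → Container T (suc j) u v
    container {j = j} strong 2+k≤m
      with ps , |ps| , cs , ps↭ ← span asym Vs-unique (route strong (≤-trans (s≤s (s≤s (s≤s z≤n))) 2+k≤m))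
             (initial-system strong 2+k≤m) (<-wellFounded _)
      = subst (λ k → Container T k u v) |ps|
          (chains⇒container u≢v ps cs (Unique-resp-↭ (↭-sym ps↭) Vs-unique) ps↭ ∈-Vs⁻ Vs-cover
            (subst Fin (sym |ps|) zero))

theorem3p1 : (k : ℕ) → 2 ≤ k →
    (n : ℕ) (T : Digraph (Fin n)) → IsTournament T →
    IsStrong (2 * k) T → StarStronglyConnected k T
theorem3p1 k@(suc _) 2≤k n T tournament strong u v u≢v =
  -- The paths run against the arc between `u` and `v`, so which side of the container is built
  -- depends on its direction.
  [ (λ uv → inj₂ (container tournament (≢-sym u≢v) uv strong 2+k≤2k))
  , (λ vu → inj₁ (container tournament u≢v vu strong 2+k≤2k)) ]′ (total tournament u≢v)
  where
  -- The connectivity must allow for the two additional chains; this is where `2 ≤ k` enters.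
  2+k≤2k : 2 + k ≤ 2 * k
  2+k≤2k = subst (2 + k ≤_) (cong (k +_) (sym (+-identityʳ k))) (+-monoˡ-≤ k 2≤k)
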